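{- Let $r$ and $n$ be integers such that $1 \le r \le n$ and $n \equiv 0 \pmod r$. For $k \ge 2$, if $F_1, F_2, \ldots, F_k$ are graphs on a common set of $n$ vertices, each of which consists of the vertex-disjoint union of $n/r$ copies of $K_r$, then \[ \gamma_{\rm sd}(F_1,F_2,\ldots,F_k) \le \begin{cases} \left( \dfrac{k}{2r} \right) n & \text{if } k \text{ is even}, \\[2mm] \left( \dfrac{r(k+1) - 2}{2r^2} \right) n & \text{if } k \text{ is odd}. \end{cases} \]
   Context: All graphs are finite and simple. Given graphs $F_1,\ldots,F_k$ (called factors; not necessarily edge-disjoint) with common vertex set $V$, a set $S \subseteq V$ is a simultaneous dominating set if for every $i$, $1 \le i \le k$, every vertex not in $S$ is adjacent in $F_i$ to some vertex of $S$. The simultaneous domination number $\gamma_{\rm sd}(F_1,\ldots,F_k)$ is the minimum cardinality of a simultaneous dominating set. -}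

module Defs where

open import Data.Fin.Base using (Fin)
open import Data.Fin.Properties using (_≟_; all?; any?)
open import Data.Fin.Subset using (Subset; _∈_; _∉_; ∣_∣; ⊤)
open import Data.Fin.Subset.Properties using (_∈?_; ∈⊤; anySubset?)
open import Data.Nat.Base using (ℕ; zero; suc; _*_; _^_; _≤_; z≤n; s≤s; NonZero)
import Data.Nat.Properties as ℕ
open import Data.Product.Base using (∃; _×_; _,_; proj₁; proj₂)
open import Function.Base using (_∘_)
open import Function.Bundles using (_↔_; _⇔_; Inverse)
open import Relation.Binary.Core using (Rel)
open import Relation.Binary.Definitions using (Symmetric; Irreflexive)
  renaming (Decidable to Decidable₂)
open import Relation.Binary.PropositionalEquality
  using (_≡_; _≢_; refl; sym; ≢-sym)
open import Relation.Nullary.Decidable using (yes; no; ¬?; _×-dec_; _→-dec_)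
open import Relation.Nullary.Negation using (contradiction)
open import Relation.Unary using (Pred; Decidable)
import Level

-- Decidability of adjacency is no restriction classically; constructively it is
-- what makes the domination number below exist.
record Graph (V : Set) : Set₁ where
  field
    Adj    : Rel V Level.zero
    symm   : Symmetric Adj
    irrefl : Irreflexive _≡_ Adj
    adj?   : Decidable₂ Adj

open Graph public

infix 4 _≅_

record _≅_ {V W : Set} (G : Graph V) (H : Graph W) : Set where
  field
    bijection : V ↔ W
    adjacency : ∀ u v → Adj G u v ⇔ Adj H (Inverse.to bijection u) (Inverse.to bijection v)

K : ∀ r → Graph (Fin r)
K r = record
  { Adj    = _≢_
  ; symm   = ≢-sym
  ; irrefl = λ x≡y x≢y → x≢y x≡y
  ; adj?   = λ x y → ¬? (x ≟ y)
  }

-- The vertex-disjoint union of m copies of G; the vertex (i , x) is the vertex x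
-- of the i-th copy.
copies : ∀ {V} m → Graph V → Graph (Fin m × V)
copies m G = record
  { Adj    = λ (i , x) (j , y) → i ≡ j × Adj G x y
  ; symm   = λ (i≡j , x~y) → sym i≡j , symm G x~y
  ; irrefl = λ { refl (_ , x~x) → irrefl G refl x~x }
  ; adj?   = λ (i , x) (j , y) → (i ≟ j) ×-dec adj? G x y
  }

IsMinimum : Pred ℕ Level.zero → ℕ → Set
IsMinimum P m = P m × (∀ j → P j → m ≤ j)

minimum : ∀ {P} → Decidable P → ∀ n → P n → ∃ (IsMinimum P)
minimum P? zero    p = zero , p , λ _ _ → z≤n
minimum P? (suc n) p with P? zero
... | yes p₀ = zero , p₀ , λ _ _ → z≤n
... | no ¬p₀ with m , pₘ , m≤ ← minimum (P? ∘ suc) n p =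
  suc m , pₘ , λ { zero p₀ → contradiction p₀ ¬p₀ ; (suc j) pⱼ → s≤s (m≤ j pⱼ) }

module _ {n k : ℕ} (F : Fin k → Graph (Fin n)) where

  SimDominating : Subset n → Set
  SimDominating S = ∀ i v → v ∉ S → ∃ λ u → u ∈ S × Adj (F i) v u

  simDominating? : Decidable SimDominating
  simDominating? S = all? λ i → all? λ v →
    ¬? (v ∈? S) →-dec any? λ u → (u ∈? S) ×-dec adj? (F i) v u

  SimDominatingSetOfSize : ℕ → Set
  SimDominatingSetOfSize d = ∃ λ S → SimDominating S × ∣ S ∣ ≡ d

  minimumSize : ∃ (IsMinimum SimDominatingSetOfSize)
  minimumSize = minimum
    (λ d → anySubset? λ S → simDominating? S ×-dec (∣ S ∣ ℕ.≟ d))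
    ∣ ⊤ {n} ∣
    (⊤ , (λ _ _ v∉⊤ → contradiction ∈⊤ v∉⊤) , refl)

  γsd : ℕ
  γsd = proj₁ minimumSize

  γsd-isMinimum : IsMinimum SimDominatingSetOfSize γsd
  γsd-isMinimum = proj₂ minimumSize

2*r≢0 : ∀ r .{{_ : NonZero r}} → NonZero (2 * r)
2*r≢0 r = ℕ.m*n≢0 2 r

2*r²≢0 : ∀ r .{{_ : NonZero r}} → NonZero (2 * r ^ 2)
2*r²≢0 r = ℕ.m*n≢0 2 (r ^ 2) {{_}} {{ℕ.m^n≢0 r 2}}

{-# OPTIONS --safe #-}
module Submission where

-- A set is simultaneously dominating as soon as it meets every clique of every
-- factor. View two factors as the sides of an r-regular bipartite multigraph: its
-- vertices are the cliques, its edges the elements of V. As in Gupta's theorem, its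
-- edges can be coloured with r colours so that every vertex sees every colour: while
-- x misses α, it sees some β twice, and a new 2-colouring of the edges coloured α or β
-- which shows both colours wherever two such edges meet lowers the number of unseen
-- colours.
-- Some colour class then has at most n/r elements and meets all cliques of both
-- factors, so each pair of factors costs n/r. For odd k, treat three factors at once:
-- fix a representative of each clique of the third factor and add to a colour class
-- the representatives of other colours; on average over the colours, this costs
-- (2 - 1/r)(n/r).

open import Defs
import Data.Nat.Properties as ℕ
open import Algebra.Properties.CommutativeMonoid.Sum ℕ.+-0-commutativeMonoid
  using (sum; sum-cong-≗; sum-remove; ∑-comm; ∑-distrib-+)
open import Data.Bool.Base using (Bool; true; false; not; if_then_else_)
import Data.Bool.Properties as Bool
import Data.Empty as Empty
open import Data.Fin.Base as Fin using (Fin; zero; suc; punchIn; punchOut)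
open import Data.Fin.Properties as Fin
  using (_≟_; any?; all?; ¬∀⟶∃¬; pigeonhole; punchIn-punchOut; punchInᵢ≢i; punchOut-injective)
open import Data.Fin.Subset using (Subset; _∈_; _⊆_; ∣_∣; ⊥; ⁅_⁆; _∪_; inside; outside)
open import Data.Fin.Subset.Properties using (∣⊥∣≡0; ∣⁅x⁆∣≡1; x∈⁅x⁆; p⊆p∪q; q⊆p∪q)
open import Data.Integer.Base as ℤ using (+_)
import Data.Integer.Properties as ℤ
import Data.Integer.Tactic.RingSolver as ℤ
open import Data.Nat.Base as ℕ using (ℕ; zero; suc; NonZero; z≤n; s≤s)
open import Data.Nat.Divisibility using (_∣_; _∤_; divides)
open import Data.Nat.DivMod using (m≡m%n+[m/n]*n)
open import Data.Nat.Induction using (<-wellFounded)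
import Data.Nat.Tactic.RingSolver as ℕ
open import Data.Product.Base using (∃; ∃₂; _×_; _,_; proj₁; proj₂)
open import Data.Rational.Base using (_/_; _*_; _≤_; toℚᵘ)
import Data.Rational.Properties as ℚ
import Data.Rational.Unnormalised.Base as ℚᵘ
import Data.Rational.Unnormalised.Properties as ℚᵘ
open import Data.Sum.Base using (_⊎_; inj₁; inj₂)
open import Data.Vec.Base using ([]; _∷_)
open import Function.Base using (_∘_; id)
open import Function.Bundles using (_↔_; Inverse; Injection; Equivalence)
open import Function.Properties.Inverse using (↔⇒↣; ↔-sym)
open import Induction.WellFounded using (Acc; acc)
open import Level using (0ℓ)
open import Relation.Binary.Core using (Rel)
open import Relation.Binary.Definitions using (Symmetric; tri<; tri≈; tri>)
  renaming (Decidable to Decidable₂)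
open import Relation.Binary.PropositionalEquality
open import Relation.Nullary.Decidable using (Dec; yes; no; does; ¬?; _×-dec_; _⊎-dec_)
open import Relation.Nullary.Negation using (¬_; contradiction)
open import Relation.Unary using (Pred; Decidable)

-- Two-colourings that split two disjoint families at once

private variable
  m n r : ℕ

Twice : Pred (Fin n) 0ℓ → Set
Twice P = ∃₂ λ v w → v ≢ w × P v × P w

twice? : {P : Pred (Fin n) 0ℓ} → Decidable P → Dec (Twice P)
twice? P? = any? λ v → any? λ w → ¬? (v ≟ w) ×-dec (P? v ×-dec P? w)

Bichromatic : (Fin n → Bool) → Pred (Fin n) 0ℓ → Set
Bichromatic f P = ∀ t → ∃ λ v → f v ≡ t × P v

bichromatic : ∀ {f : Fin n → Bool} {P : Pred (Fin n) 0ℓ} {u w} →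
              f u ≡ not (f w) → P u → P w → Bichromatic f P
bichromatic {f = f} {w = w} fu≡ Pu Pw t with f w Bool.≟ t
... | yes fw≡t = w , fw≡t , Pw
... | no  fw≢t = _ , trans fu≡ (sym (Bool.¬-not (fw≢t ∘ sym))) , Pu

Disjoint : (Fin m → Pred (Fin n) 0ℓ) → Set
Disjoint P = ∀ {x y v} → P x v → P y v → x ≡ y

-- A matching that need not be perfect: an element may have no partner.
record Pairing (n : ℕ) : Set₁ where
  field
    _~_     : Rel (Fin n) 0ℓ
    ~-sym   : Symmetric _~_
    distinct : ∀ {v w} → v ~ w → v ≢ w
    unique  : ∀ {v w w′} → v ~ w → v ~ w′ → w ≡ w′
    _~?_    : Decidable₂ _~_

Separates : (Fin n → Bool) → Pairing n → Set
Separates f T = ∀ {v w} → v ~ w → f v ≡ not (f w)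
  where open Pairing T

-- The larger member of each pair gets `true`, everything else `false`.
separate : (T : Pairing n) → ∃ λ f → Separates f T
separate T = f , sep
  where
  open Pairing T
  lower? : ∀ v → Dec (∃ λ w → w Fin.< v × v ~ w)
  lower? v = any? λ w → (w Fin.<? v) ×-dec (v ~? w)
  f : Fin _ → Bool
  f v = does (lower? v)
  sep : Separates f T
  sep {v} {w} v~w with lower? v | lower? w
  ... | yes _ | no _ = refl
  ... | no _  | yes _ = refl
  ... | yes (x , x<v , v~x) | yes (y , y<w , w~y)
    with refl ← unique v~w v~x | refl ← unique (~-sym v~w) w~y =
    contradiction x<v (Fin.<-asym y<w)
  ... | no ¬v | no ¬w with Fin.<-cmp v w
  ...   | tri< v<w _ _ = contradiction (v , v<w , ~-sym v~w) ¬w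
  ...   | tri≈ _ v≡w _ = contradiction v≡w (distinct v~w)
  ...   | tri> _ _ w<v = contradiction (w , w<v , v~w) ¬v

-- Removing the pair {u, u′} and linking the partners of u and u′ keeps a pairing. A
-- function separating the linked partners extends to u and u′ with opposite values.
module Shortcut (T : Pairing n) {u u′ : Fin n} (u≢u′ : u ≢ u′) where
  open Pairing T

  Outside : Pred (Fin n) 0ℓ
  Outside v = v ≢ u × v ≢ u′

  outside? : Decidable Outside
  outside? v = ¬? (v ≟ u) ×-dec ¬? (v ≟ u′)

  Linked : Rel (Fin n) 0ℓ
  Linked v w = v ~ w ⊎ (v ~ u × u′ ~ w) ⊎ (v ~ u′ × u ~ w)

  shortcut : Pairing n
  shortcut = record
    { _~_      = λ v w → Outside v × Outside w × Linked v w
    ; ~-sym    = λ { (ov , ow , l) → ow , ov , linked-sym l }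
    ; distinct = λ { (_ , _ , l) → linked-distinct l }
    ; unique   = λ { (ov , ow , l) (_ , ow′ , l′) → linked-unique ow ow′ l l′ }
    ; _~?_     = λ v w → outside? v ×-dec (outside? w ×-dec
        ((v ~? w) ⊎-dec (((v ~? u) ×-dec (u′ ~? w)) ⊎-dec ((v ~? u′) ×-dec (u ~? w)))))
    }
    where
    linked-sym : Symmetric Linked
    linked-sym (inj₁ v~w) = inj₁ (~-sym v~w)
    linked-sym (inj₂ (inj₁ (v~u , u′~w))) = inj₂ (inj₂ (~-sym u′~w , ~-sym v~u))
    linked-sym (inj₂ (inj₂ (v~u′ , u~w))) = inj₂ (inj₁ (~-sym u~w , ~-sym v~u′))

    linked-distinct : ∀ {v w} → Linked v w → v ≢ w
    linked-distinct (inj₁ v~w) = distinct v~w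
    linked-distinct (inj₂ (inj₁ (v~u , u′~w))) refl = u≢u′ (unique v~u (~-sym u′~w))
    linked-distinct (inj₂ (inj₂ (v~u′ , u~w))) refl = u≢u′ (unique (~-sym u~w) v~u′)

    linked-unique : ∀ {v w w′} → Outside w → Outside w′ → Linked v w → Linked v w′ → w ≡ w′
    linked-unique _ _ (inj₁ p) (inj₁ q) = unique p q
    linked-unique (w≢u , _) _ (inj₁ p) (inj₂ (inj₁ (q , _))) = contradiction (unique p q) w≢u
    linked-unique (_ , w≢u′) _ (inj₁ p) (inj₂ (inj₂ (q , _))) = contradiction (unique p q) w≢u′
    linked-unique _ (w≢u , _) (inj₂ (inj₁ (p , _))) (inj₁ q) = contradiction (unique q p) w≢u
    linked-unique _ (_ , w≢u′) (inj₂ (inj₂ (p , _))) (inj₁ q) = contradiction (unique q p) w≢u′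
    linked-unique _ _ (inj₂ (inj₁ (_ , p))) (inj₂ (inj₁ (_ , q))) = unique p q
    linked-unique _ _ (inj₂ (inj₂ (_ , p))) (inj₂ (inj₂ (_ , q))) = unique p q
    linked-unique _ _ (inj₂ (inj₁ (p , _))) (inj₂ (inj₂ (q , _))) = contradiction (unique p q) u≢u′
    linked-unique _ _ (inj₂ (inj₂ (p , _))) (inj₂ (inj₁ (q , _))) = contradiction (unique q p) u≢u′

  module _ {f : Fin n → Bool} (sep : Separates f shortcut) where

    -- The value for `u`; `u′` will get the opposite one. The two conditions are compatible: if `u`
    -- and `u′` both have outside partners, these are linked in `shortcut`, so `f` already gives
    -- them opposite values.
    tip : ∃ λ t → (∀ {w} → Outside w → u ~ w → t ≡ not (f w)) ×
                  (∀ {w} → Outside w → u′ ~ w → t ≡ f w)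
    tip with any? (λ w → outside? w ×-dec (u ~? w))
    ... | yes (x , ox , u~x) = not (f x)
        , (λ _ u~w → cong (not ∘ f) (unique u~x u~w))
        , (λ ow u′~w → sym (sep (ow , ox , inj₂ (inj₂ (~-sym u′~w , u~x)))))
    ... | no ¬x with any? (λ w → outside? w ×-dec (u′ ~? w))
    ...   | yes (y , _ , u′~y) = f y
        , (λ ow u~w → contradiction (_ , ow , u~w) ¬x)
        , (λ _ u′~w → cong f (unique u′~y u′~w))
    -- Neither `u` nor `u′` has an outside partner, so either value would do.
    ...   | no ¬y = true
        , (λ ow u~w → contradiction (_ , ow , u~w) ¬x)
        , (λ ow u′~w → contradiction (_ , ow , u′~w) ¬y)

    extend : Fin n → Bool
    extend v with v ≟ u | v ≟ u′
    ... | yes _ | _     = proj₁ tip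
    ... | no _  | yes _ = not (proj₁ tip)
    ... | no _  | no _  = f v

    extend-outside : ∀ {v} → Outside v → extend v ≡ f v
    extend-outside {v} (v≢u , v≢u′) with v ≟ u | v ≟ u′
    ... | yes v≡u | _        = contradiction v≡u v≢u
    ... | no _    | yes v≡u′ = contradiction v≡u′ v≢u′
    ... | no _    | no _     = refl

    extend-u : extend u ≡ proj₁ tip
    extend-u with u ≟ u
    ... | yes _  = refl
    ... | no u≢u = contradiction refl u≢u

    extend-u′ : extend u′ ≡ not (proj₁ tip)
    extend-u′ with u′ ≟ u | u′ ≟ u′
    ... | yes u′≡u | _        = contradiction (sym u′≡u) u≢u′
    ... | no _     | yes _    = refl
    ... | no _     | no u′≢u′ = contradiction refl u′≢u′

    extend-bichromatic : extend u ≡ not (extend u′)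
    extend-bichromatic = trans extend-u
      (trans (sym (Bool.not-involutive _)) (cong not (sym extend-u′)))

    private
      from-u : ∀ {w} → Outside w → u ~ w → extend u ≡ not (extend w)
      from-u ow u~w = trans extend-u
        (trans (proj₁ (proj₂ tip) ow u~w) (cong not (sym (extend-outside ow))))

      from-u′ : ∀ {w} → Outside w → u′ ~ w → extend u′ ≡ not (extend w)
      from-u′ ow u′~w = trans extend-u′
        (cong not (trans (proj₂ (proj₂ tip) ow u′~w) (sym (extend-outside ow))))

      flip : ∀ {s t} → s ≡ not t → t ≡ not s
      flip s≡¬t = trans (sym (Bool.not-involutive _)) (cong not (sym s≡¬t))

      data Position (v : Fin n) : Set where
        at-u  : v ≡ u → Position v
        at-u′ : v ≡ u′ → Position v
        out   : Outside v → Position v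

      position : ∀ v → Position v
      position v with v ≟ u | v ≟ u′
      ... | yes v≡u | _        = at-u v≡u
      ... | no _    | yes v≡u′ = at-u′ v≡u′
      ... | no v≢u  | no v≢u′  = out (v≢u , v≢u′)

    extend-separates : Separates extend T
    extend-separates {v} {w} v~w with position v | position w
    ... | at-u refl  | at-u refl  = contradiction refl (distinct v~w)
    ... | at-u refl  | at-u′ refl = extend-bichromatic
    ... | at-u refl  | out ow     = from-u ow v~w
    ... | at-u′ refl | at-u refl  = flip extend-bichromatic
    ... | at-u′ refl | at-u′ refl = contradiction refl (distinct v~w)
    ... | at-u′ refl | out ow     = from-u′ ow v~w
    ... | out ov     | at-u refl  = flip (from-u ov (~-sym v~w))
    ... | out ov     | at-u′ refl = flip (from-u′ ov (~-sym v~w))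
    ... | out ov     | out ow     = trans (extend-outside ov)
      (trans (sep (ov , ow , inj₁ v~w)) (cong not (sym (extend-outside ow))))

-- Two elements chosen from each part that has them form a matching; its union with `T` consists of
-- paths and even cycles, hence is bipartite. Induction on the number of parts replaces walking
-- along these paths: a chosen pair is cut out of `T`, the rest is coloured, and the pair is put
-- back with opposite values.
bicolour-with : (P : Fin m → Pred (Fin n) 0ℓ) → (∀ x → Decidable (P x)) → Disjoint P →
  (T : Pairing n) → ∃ λ f → (∀ x → Twice (P x) → Bichromatic f (P x)) × Separates f T
bicolour-with {zero} P P? disj T with f , sep ← separate T = f , (λ ()) , sep
bicolour-with {suc m} P P? disj T with twice? (P? zero)
... | no ¬two
  with f , bi , sep ← bicolour-with (P ∘ suc) (P? ∘ suc) (λ p q → Fin.suc-injective (disj p q)) T =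
  f , (λ { zero two → contradiction two ¬two ; (suc x) → bi x }) , sep
... | yes (u , u′ , u≢u′ , Pu , Pu′)
  with f , bi , sep ← bicolour-with (P ∘ suc) (P? ∘ suc) (λ p q → Fin.suc-injective (disj p q))
         (Shortcut.shortcut T u≢u′) =
  extend sep , bi′ , extend-separates sep
  where
  open Shortcut T u≢u′
  -- By disjointness the other parts avoid `u` and `u′`, so on them `extend` agrees with `f`.
  outside-suc : ∀ {x v} → P (suc x) v → Outside v
  outside-suc Pv = (λ { refl → contradiction (disj Pu Pv) λ () })
                 , (λ { refl → contradiction (disj Pu′ Pv) λ () })
  bi′ : ∀ x → Twice (P x) → Bichromatic (extend sep) (P x)
  bi′ zero    _   = bichromatic {f = extend sep} (extend-bichromatic sep) Pu Pu′
  bi′ (suc x) two t with v , fv≡t , Pv ← bi x two t =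
    v , trans (extend-outside sep (outside-suc Pv)) fv≡t , Pv

module _ (Q : Fin m → Pred (Fin n) 0ℓ) (Q? : ∀ y → Decidable (Q y)) (disj : Disjoint Q) where

  private
    -- The pair is read off the outcome of the search, so that each part contributes one fixed pair,
    -- in both orders, or none.
    Chosen : {P : Pred (Fin n) 0ℓ} → Dec (Twice P) → Rel (Fin n) 0ℓ
    Chosen (yes (p , q , _)) v w = (v ≡ p × w ≡ q) ⊎ (v ≡ q × w ≡ p)
    Chosen (no _)            v w = Empty.⊥

    chosen? : {P : Pred (Fin n) 0ℓ} (two : Dec (Twice P)) → Decidable₂ (Chosen two)
    chosen? (yes (p , q , _)) v w = ((v ≟ p) ×-dec (w ≟ q)) ⊎-dec ((v ≟ q) ×-dec (w ≟ p))
    chosen? (no _)            v w = no λ ()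

    chosen-sym : {P : Pred (Fin n) 0ℓ} (two : Dec (Twice P)) → Symmetric (Chosen two)
    chosen-sym (yes _) (inj₁ (v≡ , w≡)) = inj₂ (w≡ , v≡)
    chosen-sym (yes _) (inj₂ (v≡ , w≡)) = inj₁ (w≡ , v≡)

    chosen-∈ : {P : Pred (Fin n) 0ℓ} (two : Dec (Twice P)) → ∀ {v w} → Chosen two v w → P v
    chosen-∈ (yes (_ , _ , _ , Pp , _)) (inj₁ (refl , _)) = Pp
    chosen-∈ (yes (_ , _ , _ , _ , Pq)) (inj₂ (refl , _)) = Pq

    chosen-distinct : {P : Pred (Fin n) 0ℓ} (two : Dec (Twice P)) →
                      ∀ {v w} → Chosen two v w → v ≢ w
    chosen-distinct (yes (_ , _ , p≢q , _)) (inj₁ (refl , refl)) = p≢q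
    chosen-distinct (yes (_ , _ , p≢q , _)) (inj₂ (refl , refl)) = p≢q ∘ sym

    chosen-unique : {P : Pred (Fin n) 0ℓ} (two : Dec (Twice P)) →
                    ∀ {v w w′} → Chosen two v w → Chosen two v w′ → w ≡ w′
    chosen-unique (yes _) (inj₁ (_ , refl)) (inj₁ (_ , refl)) = refl
    chosen-unique (yes _) (inj₂ (_ , refl)) (inj₂ (_ , refl)) = refl
    chosen-unique (yes (_ , _ , p≢q , _)) (inj₁ (refl , _)) (inj₂ (p≡q , _)) = contradiction p≡q p≢q
    chosen-unique (yes (_ , _ , p≢q , _)) (inj₂ (refl , _)) (inj₁ (q≡p , _)) = contradiction (sym q≡p) p≢q

  pairUp : Pairing n
  pairUp = record
    { _~_      = λ v w → ∃ λ y → Chosen (twice? (Q? y)) v w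
    ; ~-sym    = λ (y , ch) → y , chosen-sym (twice? (Q? y)) ch
    ; distinct = λ (y , ch) → chosen-distinct (twice? (Q? y)) ch
    ; unique   = uniq
    ; _~?_     = λ v w → any? λ y → chosen? (twice? (Q? y)) v w
    }
    where
    uniq : ∀ {v w w′} → (∃ λ y → Chosen (twice? (Q? y)) v w) →
           (∃ λ y → Chosen (twice? (Q? y)) v w′) → w ≡ w′
    uniq (y , ch) (y′ , ch′)
      with refl ← disj (chosen-∈ (twice? (Q? y)) ch) (chosen-∈ (twice? (Q? y′)) ch′) =
      chosen-unique (twice? (Q? y)) ch ch′

  pairUp-bichromatic : ∀ {f} → Separates f pairUp → ∀ y → Twice (Q y) → Bichromatic f (Q y)
  pairUp-bichromatic {f} sep y two with twice? (Q? y) in eq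
  ... | no ¬two = contradiction two ¬two
  ... | yes (p , q , _ , Qp , Qq) = bichromatic {f = f}
    (sep (y , subst (λ d → Chosen d p q) (sym eq) (inj₁ (refl , refl)))) Qp Qq

-- The families will come from the two sides of the bipartite multigraph. `Q` enters as a pairing to
-- be separated, while `P` is worked off part by part.
bicolour : (P Q : Fin m → Pred (Fin n) 0ℓ) →
  (∀ x → Decidable (P x)) → (∀ y → Decidable (Q y)) → Disjoint P → Disjoint Q →
  ∃ λ f → (∀ x → Twice (P x) → Bichromatic f (P x)) × (∀ y → Twice (Q y) → Bichromatic f (Q y))
bicolour P Q P? Q? disjP disjQ
  with f , bi , sep ← bicolour-with P P? disjP (pairUp Q Q? disjQ) =
  f , bi , pairUp-bichromatic Q Q? disjQ sep

-- Indicators and comparison of sums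

ind : {A : Set} → Dec A → ℕ
ind A? = if does A? then 1 else 0

ind≤1 : {A : Set} (A? : Dec A) → ind A? ℕ.≤ 1
ind≤1 (yes _) = ℕ.≤-refl
ind≤1 (no _)  = z≤n

ind-mono : {A B : Set} (A? : Dec A) (B? : Dec B) → (A → B) → ind A? ℕ.≤ ind B?
ind-mono (no _)  B?      A⇒B = z≤n
ind-mono (yes _) (yes _) A⇒B = ℕ.≤-refl
ind-mono (yes a) (no ¬b) A⇒B = contradiction (A⇒B a) ¬b

sum-mono : {f g : Fin n → ℕ} → (∀ i → f i ℕ.≤ g i) → sum f ℕ.≤ sum g
sum-mono {zero}  f≤g = z≤n
sum-mono {suc n} f≤g = ℕ.+-mono-≤ (f≤g zero) (sum-mono (f≤g ∘ suc))

-- The constants serve two ends: `k = 1`, `l = 0` gives a strict inequality, and with two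
-- exceptional indices the terms at the first are moved into the constants.
sum-mono-at : ∀ k l {f g : Fin n → ℕ} x → (∀ i → i ≢ x → f i ℕ.≤ g i) →
              k ℕ.+ f x ℕ.≤ l ℕ.+ g x → k ℕ.+ sum f ℕ.≤ l ℕ.+ sum g
sum-mono-at {suc n} k l {f} {g} x f≤g kf≤lg = begin
  k ℕ.+ sum f                          ≡⟨ cong (k ℕ.+_) (sum-remove {i = x} f) ⟩
  k ℕ.+ (f x ℕ.+ sum (f ∘ punchIn x))  ≡⟨ ℕ.+-assoc k (f x) _ ⟨
  k ℕ.+ f x ℕ.+ sum (f ∘ punchIn x)    ≤⟨ ℕ.+-mono-≤ kf≤lg (sum-mono λ i → f≤g _ (punchInᵢ≢i x i)) ⟩
  l ℕ.+ g x ℕ.+ sum (g ∘ punchIn x)    ≡⟨ ℕ.+-assoc l (g x) _ ⟩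
  l ℕ.+ (g x ℕ.+ sum (g ∘ punchIn x))  ≡⟨ cong (l ℕ.+_) (sum-remove {i = x} g) ⟨
  l ℕ.+ sum g                          ∎
  where open ℕ.≤-Reasoning

sum-mono-at₂ : ∀ k {f g : Fin n → ℕ} {x y} → x ≢ y → (∀ i → i ≢ x → i ≢ y → f i ℕ.≤ g i) →
               k ℕ.+ (f x ℕ.+ f y) ℕ.≤ g x ℕ.+ g y → k ℕ.+ sum f ℕ.≤ sum g
sum-mono-at₂ {suc n} k {f} {g} {x} {y} x≢y f≤g kf≤g = begin
  k ℕ.+ sum f                          ≡⟨ cong (k ℕ.+_) (sum-remove {i = x} f) ⟩
  k ℕ.+ (f x ℕ.+ sum (f ∘ punchIn x))  ≡⟨ ℕ.+-assoc k (f x) _ ⟨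
  k ℕ.+ f x ℕ.+ sum (f ∘ punchIn x)    ≤⟨ sum-mono-at (k ℕ.+ f x) (g x) y′ f≤g′ at-y ⟩
  g x ℕ.+ sum (g ∘ punchIn x)          ≡⟨ sum-remove {i = x} g ⟨
  sum g                                ∎
  where
  open ℕ.≤-Reasoning
  y′ = punchOut x≢y
  xy≡y : punchIn x y′ ≡ y
  xy≡y = punchIn-punchOut x≢y
  f≤g′ : ∀ i → i ≢ y′ → f (punchIn x i) ℕ.≤ g (punchIn x i)
  f≤g′ i i≢y′ = f≤g _ (punchInᵢ≢i x i)
    (λ eq → i≢y′ (Fin.punchIn-injective x i y′ (trans eq (sym xy≡y))))
  at-y : k ℕ.+ f x ℕ.+ f (punchIn x y′) ℕ.≤ g x ℕ.+ g (punchIn x y′)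
  at-y rewrite xy≡y | ℕ.+-assoc k (f x) (f y) = kf≤g

-- Colourings in which every block sees every colour

module _ {m n r : ℕ} where

  Sees : (Fin n → Fin m) → (Fin n → Fin r) → Fin m → Fin r → Set
  Sees a c x γ = ∃ λ v → a v ≡ x × c v ≡ γ

  sees? : ∀ a c x γ → Dec (Sees a c x γ)
  sees? a c x γ = any? λ v → (a v ≟ x) ×-dec (c v ≟ γ)

  SeesAll : (Fin n → Fin m) → (Fin n → Fin r) → Set
  SeesAll a c = ∀ x γ → Sees a c x γ

  unseenAt : (Fin n → Fin m) → (Fin n → Fin r) → Fin m → ℕ
  unseenAt a c x = sum λ γ → ind (¬? (sees? a c x γ))

  unseen : (Fin n → Fin m) → (Fin n → Fin r) → ℕ
  unseen a c = sum (unseenAt a c)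

  Either : Fin r → Fin r → Pred (Fin r) 0ℓ
  Either α β γ = γ ≡ α ⊎ γ ≡ β

  TwiceEither : (Fin n → Fin m) → (Fin n → Fin r) → Fin r → Fin r → Fin m → Set
  TwiceEither a c α β x = Twice λ v → a v ≡ x × Either α β (c v)

  -- Isolates what the count of unseen colours asks of a recolouring on one side `a`; a single `c′`
  -- has to provide it for both sides.
  record Improves (a : Fin n → Fin m) (α β : Fin r) (c c′ : Fin n → Fin r) : Set where
    field
      others : ∀ {x γ} → γ ≢ α → γ ≢ β → Sees a c x γ → Sees a c′ x γ
      within : ∀ {v} → Either α β (c v) → Either α β (c′ v)
      both   : ∀ {x} → TwiceEither a c α β x → Sees a c′ x α × Sees a c′ x β

  module _ {a : Fin n → Fin m} {α β} (α≢β : α ≢ β) {c c′} (imp : Improves a α β c c′) where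
    open Improves imp

    -- Only the terms of `α` and `β` could grow. If `x` saw neither, nothing can be lost; if it saw
    -- both, two elements meet there and `both` applies; if it saw exactly one, `within` keeps at
    -- least one of the two visible.
    unseenAt-mono : ∀ x → unseenAt a c′ x ℕ.≤ unseenAt a c x
    unseenAt-mono x = sum-mono-at₂ 0 α≢β
      (λ γ γ≢α γ≢β → ind-mono (¬? (sees? a c′ x γ)) (¬? (sees? a c x γ)) (_∘ others γ≢α γ≢β))
      at-αβ
      where
      at-αβ : ind (¬? (sees? a c′ x α)) ℕ.+ ind (¬? (sees? a c′ x β)) ℕ.≤
              ind (¬? (sees? a c x α)) ℕ.+ ind (¬? (sees? a c x β))
      at-αβ with sees? a c x α | sees? a c x β
      ... | no _ | no _ = ℕ.+-mono-≤ (ind≤1 (¬? (sees? a c′ x α))) (ind≤1 (¬? (sees? a c′ x β)))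
      ... | yes (v , av≡x , cv≡α) | yes (w , aw≡x , cw≡β)
        with sees? a c′ x α | sees? a c′ x β | both
          (v , w , (λ { refl → α≢β (trans (sym cv≡α) cw≡β) }) , (av≡x , inj₁ cv≡α) , (aw≡x , inj₂ cw≡β))
      ...   | yes _ | yes _ | _ = z≤n
      ...   | no ¬s | _     | s , _ = contradiction s ¬s
      ...   | _     | no ¬s | _ , s = contradiction s ¬s
      at-αβ | yes (v , av≡x , cv≡α) | no _
        with sees? a c′ x α | sees? a c′ x β | within (inj₁ cv≡α)
      ...   | yes _ | d     | _ = ind≤1 (¬? d)
      ...   | no _  | yes _ | _ = ℕ.≤-refl
      ...   | no ¬α | no _  | inj₁ c′v≡α = contradiction (v , av≡x , c′v≡α) ¬α
      ...   | no _  | no ¬β | inj₂ c′v≡β = contradiction (v , av≡x , c′v≡β) ¬β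
      at-αβ | no _ | yes (v , av≡x , cv≡β)
        with sees? a c′ x α | sees? a c′ x β | within (inj₂ cv≡β)
      ...   | yes _ | d     | _ = ind≤1 (¬? d)
      ...   | no _  | yes _ | _ = ℕ.≤-refl
      ...   | no ¬α | no _  | inj₁ c′v≡α = contradiction (v , av≡x , c′v≡α) ¬α
      ...   | no _  | no ¬β | inj₂ c′v≡β = contradiction (v , av≡x , c′v≡β) ¬β

    -- Afterwards `x` sees both `α` and `β`, whereas `α` was missing before; the other terms do not
    -- grow.
    unseenAt-strict : ∀ {x} → TwiceEither a c α β x → ¬ Sees a c x α →
                      unseenAt a c′ x ℕ.< unseenAt a c x
    unseenAt-strict {x} two ¬sα = sum-mono-at₂ 1 α≢β
      (λ γ γ≢α γ≢β → ind-mono (¬? (sees? a c′ x γ)) (¬? (sees? a c x γ)) (_∘ others γ≢α γ≢β))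
      at-αβ
      where
      at-αβ : ind (¬? (sees? a c′ x α)) ℕ.+ ind (¬? (sees? a c′ x β)) ℕ.<
              ind (¬? (sees? a c x α)) ℕ.+ ind (¬? (sees? a c x β))
      at-αβ with sees? a c x α | sees? a c′ x α | sees? a c′ x β | both two
      ... | yes s | _     | _     | _     = contradiction s ¬sα
      ... | no _  | no ¬s | _     | s , _ = contradiction s ¬s
      ... | no _  | yes _ | no ¬s | _ , s = contradiction s ¬s
      ... | no _  | yes _ | yes _ | _     = s≤s z≤n

    unseen-mono : unseen a c′ ℕ.≤ unseen a c
    unseen-mono = sum-mono unseenAt-mono

    unseen-strict : ∀ {x} → TwiceEither a c α β x → ¬ Sees a c x α → unseen a c′ ℕ.< unseen a c
    unseen-strict {x} two ¬sα =
      sum-mono-at 1 0 x (λ i _ → unseenAt-mono i) (unseenAt-strict two ¬sα)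

  -- The elements coloured `α` or `β`, grouped by `a` and by `b`, form two disjoint families. A
  -- common two-colouring from `bicolour` is read as a choice between `α` and `β`.
  recolour : ∀ (a b : Fin n → Fin m) {α β} → α ≢ β → (c : Fin n → Fin r) →
             ∃ λ c′ → Improves a α β c c′ × Improves b α β c c′
  recolour a b {α} {β} α≢β c = c′ , improves a biA , improves b biB
    where
    either? : Decidable (Either α β)
    either? γ = (γ ≟ α) ⊎-dec (γ ≟ β)

    P : (Fin n → Fin m) → Fin m → Pred (Fin n) 0ℓ
    P d x v = d v ≡ x × Either α β (c v)

    P? : ∀ d x → Decidable (P d x)
    P? d x v = (d v ≟ x) ×-dec either? (c v)

    disjoint : ∀ d → Disjoint (P d)
    disjoint d (dv≡x , _) (dv≡y , _) = trans (sym dv≡x) dv≡y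

    bi = bicolour (P a) (P b) (P? a) (P? b) (disjoint a) (disjoint b)
    f = proj₁ bi
    biA = proj₁ (proj₂ bi)
    biB = proj₂ (proj₂ bi)

    c′ : Fin n → Fin r
    c′ v with either? (c v)
    ... | yes _ = if f v then α else β
    ... | no _  = c v

    c′-either : ∀ {v} → Either α β (c v) → c′ v ≡ (if f v then α else β)
    c′-either {v} e with either? (c v)
    ... | yes _ = refl
    ... | no ¬e = contradiction e ¬e

    c′-other : ∀ {v} → ¬ Either α β (c v) → c′ v ≡ c v
    c′-other {v} ¬e with either? (c v)
    ... | yes e = contradiction e ¬e
    ... | no _  = refl

    if-either : ∀ t → Either α β (if t then α else β)
    if-either true  = inj₁ refl
    if-either false = inj₂ refl

    improves : ∀ d → (∀ x → Twice (P d x) → Bichromatic f (P d x)) → Improves d α β c c′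
    improves d bi = record
      { others = λ { γ≢α γ≢β (v , dv≡x , refl) →
          v , dv≡x , c′-other λ { (inj₁ eq) → γ≢α eq ; (inj₂ eq) → γ≢β eq } }
      ; within = λ {v} e → subst (Either α β) (sym (c′-either e)) (if-either (f v))
      ; both   = λ {x} two → see x two true , see x two false
      }
      where
      see : ∀ x → Twice (P d x) → ∀ t → Sees d c′ x (if t then α else β)
      see x two t with v , fv≡t , dv≡x , e ← bi x two t =
        v , dv≡x , trans (c′-either e) (cong (if_then α else β) fv≡t)

  -- Every vertex of the multigraph has degree at least `r`, stated as an injection to suit the
  -- pigeonhole principle.
  MinDegree : (Fin n → Fin m) → Set
  MinDegree a = ∀ x → ∃ λ (ι : Fin r → Fin n) → (∀ {i j} → ι i ≡ ι j → i ≡ j) × (∀ i → a (ι i) ≡ x)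

-- With `α` deleted from the palette by `punchOut`, one colour fewer remains than there are chosen
-- elements at `x`, so two of them share a colour `β`.
repeated : ∀ {a : Fin n → Fin m} {c : Fin n → Fin r} {x α} → MinDegree {r = r} a →
           ¬ Sees a c x α → ∃ λ β → α ≢ β × TwiceEither a c α β x
repeated {r = suc r} {c = c} {x} {α} deg ¬sα
  with ι , inj , at ← deg x
  with i , j , i<j , eq ← pigeonhole (ℕ.n<1+n r)
         (λ i → punchOut {i = α} {c (ι i)} λ eq → ¬sα (ι i , at i , sym eq))
  = c (ι i) , (λ eq → ¬sα (ι i , at i , sym eq)) , ι i , ι j , Fin.<⇒≢ i<j ∘ inj
  , (at i , inj₂ refl) , (at j , inj₂ (sym (punchOut-injective {i = α} _ _ eq)))

reduceUnseen : ∀ {a b : Fin n → Fin m} {c : Fin n → Fin r} {x α} → MinDegree {r = r} a →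
  ¬ Sees a c x α → ∃ λ (c′ : Fin n → Fin r) → unseen a c′ ℕ.< unseen a c × unseen b c′ ℕ.≤ unseen b c
reduceUnseen {a = a} {b} {c} deg ¬sα
  with β , α≢β , two ← repeated deg ¬sα
  with c′ , impA , impB ← recolour a b α≢β c =
  c′ , unseen-strict α≢β impA two ¬sα , unseen-mono α≢β impB

seesAll? : (a : Fin n → Fin m) (c : Fin n → Fin r) →
           SeesAll a c ⊎ ∃₂ λ x γ → ¬ Sees a c x γ
seesAll? a c with all? (λ x → all? (sees? a c x))
... | yes all = inj₁ all
... | no ¬all
  with x , ¬all-x ← ¬∀⟶∃¬ _ _ (λ x → all? (sees? a c x)) ¬all
  with γ , ¬s ← ¬∀⟶∃¬ _ _ (sees? a c x) ¬all-x = inj₂ (x , γ , ¬s)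

abstract
  -- Descent on the total number of unseen colours: a defect on one side can be reduced without
  -- raising the count on the other.
  rainbow : ∀ {a b : Fin n → Fin m} → MinDegree {r = r} a → MinDegree {r = r} b →
            (Fin n → Fin r) → ∃ λ (c : Fin n → Fin r) → SeesAll a c × SeesAll b c
  rainbow {n} {m} {r} {a} {b} degA degB c = go c (<-wellFounded _)
    where
    go : (c : Fin n → Fin r) → Acc ℕ._<_ (unseen a c ℕ.+ unseen b c) →
         ∃ λ (c : Fin n → Fin r) → SeesAll a c × SeesAll b c
    go c (acc rec) with seesAll? a c | seesAll? b c
    ... | inj₁ allA | inj₁ allB = c , allA , allB
    ... | inj₂ (_ , _ , ¬s) | _ with c′ , a< , b≤ ← reduceUnseen {b = b} degA ¬s =
      go c′ (rec (ℕ.+-mono-<-≤ a< b≤))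
    ... | _ | inj₂ (_ , _ , ¬s) with c′ , b< , a≤ ← reduceUnseen {b = a} degB ¬s =
      go c′ (rec (ℕ.+-mono-≤-< a≤ b<))

-- Averaging, double counting and sizes of subsets

abstract
  -- Take whichever of `zero` and the index found in the tail has the smaller value; the product
  -- form avoids division.
  below-average : (f : Fin (suc r) → ℕ) → ∃ λ j → suc r ℕ.* f j ℕ.≤ sum f
  below-average {zero}  f = zero , ℕ.≤-refl
  below-average {suc r} f with j , h ← below-average (f ∘ suc) with ℕ.≤-total (f zero) (f (suc j))
  ... | inj₁ f₀≤ = zero , ℕ.+-monoʳ-≤ (f zero) (ℕ.≤-trans (ℕ.*-monoʳ-≤ (suc r) f₀≤) h)
  ... | inj₂ f₀≥ = suc j , ℕ.+-mono-≤ f₀≥ h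

sum-const : ∀ n k → sum {n} (λ _ → k) ≡ n ℕ.* k
sum-const zero    k = refl
sum-const (suc n) k = cong (k ℕ.+_) (sum-const n k)

-- Double counting by exchanging the sums; it will be used with colours as rows.
sum-columns : (f : Fin m → Fin n → ℕ) {k : ℕ} → (∀ i → sum (λ j → f j i) ≡ k) →
              sum (λ j → sum (f j)) ≡ n ℕ.* k
sum-columns {n = n} f {k} eq = trans (∑-comm f) (trans (sum-cong-≗ eq) (sum-const n k))

sum-ind-≟ : (x : Fin r) → sum (λ j → ind (x ≟ j)) ≡ 1
sum-ind-≟ {suc r} zero    = cong suc (trans (sum-const r 0) (ℕ.*-zeroʳ r))
sum-ind-≟ {suc r} (suc x) = sum-ind-≟ x

sum-ind-≢ : (x : Fin (suc r)) → sum (λ j → ind (¬? (x ≟ j))) ≡ r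
sum-ind-≢ {r}     zero    = trans (sum-const r 1) (ℕ.*-identityʳ r)
sum-ind-≢ {suc r} (suc x) = cong suc (sum-ind-≢ x)

∣p∪q∣≤∣p∣+∣q∣ : (p q : Subset n) → ∣ p ∪ q ∣ ℕ.≤ ∣ p ∣ ℕ.+ ∣ q ∣
∣p∪q∣≤∣p∣+∣q∣ []            []            = z≤n
∣p∪q∣≤∣p∣+∣q∣ (outside ∷ p) (outside ∷ q) = ∣p∪q∣≤∣p∣+∣q∣ p q
∣p∪q∣≤∣p∣+∣q∣ (inside  ∷ p) (outside ∷ q) = s≤s (∣p∪q∣≤∣p∣+∣q∣ p q)
∣p∪q∣≤∣p∣+∣q∣ (outside ∷ p) (inside  ∷ q) =
  ℕ.≤-trans (s≤s (∣p∪q∣≤∣p∣+∣q∣ p q)) (ℕ.≤-reflexive (sym (ℕ.+-suc _ _)))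
∣p∪q∣≤∣p∣+∣q∣ (inside  ∷ p) (inside  ∷ q) =
  s≤s (ℕ.≤-trans (∣p∪q∣≤∣p∣+∣q∣ p q) (ℕ.+-monoʳ-≤ ∣ p ∣ (ℕ.n≤1+n _)))

image : {P : Pred (Fin m) 0ℓ} → (Fin m → Fin n) → Decidable P → Subset n
image {zero}  e P? = ⊥
image {suc m} e P? = (if does (P? zero) then ⁅ e zero ⁆ else ⊥) ∪ image (e ∘ suc) (P? ∘ suc)

∈-image : ∀ (e : Fin m → Fin n) {P : Pred (Fin m) 0ℓ} (P? : Decidable P) {i} → P i → e i ∈ image e P?
∈-image e P? {zero} p with P? zero
... | yes _ = p⊆p∪q _ (x∈⁅x⁆ (e zero))
... | no ¬p = contradiction p ¬p
∈-image e P? {suc i} p = q⊆p∪q _ _ (∈-image (e ∘ suc) (P? ∘ suc) p)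

-- An inequality, since `e` may send several indices to the same element.
∣image∣ : ∀ (e : Fin m → Fin n) {P : Pred (Fin m) 0ℓ} (P? : Decidable P) →
          ∣ image e P? ∣ ℕ.≤ sum λ i → ind (P? i)
∣image∣ {zero} {n} e P? = ℕ.≤-reflexive (∣⊥∣≡0 n)
∣image∣ {suc m} {n} e P? = ℕ.≤-trans
  (∣p∪q∣≤∣p∣+∣q∣ (if does (P? zero) then ⁅ e zero ⁆ else ⊥) (image (e ∘ suc) (P? ∘ suc)))
  (ℕ.+-mono-≤ head (∣image∣ (e ∘ suc) (P? ∘ suc)))
  where
  head : ∣ (if does (P? zero) then ⁅ e zero ⁆ else ⊥) ∣ ℕ.≤ ind (P? zero)
  head with does (P? zero)
  ... | true  = ℕ.≤-reflexive (∣⁅x⁆∣≡1 (e zero))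
  ... | false = ℕ.≤-reflexive (∣⊥∣≡0 n)

-- Small sets meeting every clique

-- The bijection underlying an isomorphism with `copies m (K r)`: it names the clique of a vertex
-- and its position there.
Blocks : ℕ → ℕ → ℕ → Set
Blocks n m r = Fin n ↔ (Fin m × Fin r)

block : Blocks n m r → Fin n → Fin m
block φ = proj₁ ∘ Inverse.to φ

block-from : (φ : Blocks n m r) → ∀ x q → block φ (Inverse.from φ (x , q)) ≡ x
block-from φ x q = cong proj₁ (Inverse.strictlyInverseˡ φ (x , q))

to-injective : (φ : Blocks n m r) → ∀ {v w} → Inverse.to φ v ≡ Inverse.to φ w → v ≡ w
to-injective φ = Injection.injective (↔⇒↣ φ)

from-injective : (φ : Blocks n m r) → ∀ {p q} → Inverse.from φ p ≡ Inverse.from φ q → p ≡ q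
from-injective φ = Injection.injective (↔⇒↣ (↔-sym φ))

block-minDegree : (φ : Blocks n m r) → MinDegree {r = r} (block φ)
block-minDegree φ x =
  (λ q → Inverse.from φ (x , q)) , (λ eq → cong proj₂ (from-injective φ eq)) , block-from φ x

Hits : Blocks n m r → Subset n → Set
Hits φ S = ∀ x → ∃ λ v → v ∈ S × block φ v ≡ x

hits-⊆ : ∀ (φ : Blocks n m r) {S T} → S ⊆ T → Hits φ S → Hits φ T
hits-⊆ φ S⊆T hits x with v , v∈S , eq ← hits x = v , S⊆T v∈S , eq

colourClass : (Fin n → Fin r) → Fin r → Subset n
colourClass c j = image id λ v → c v ≟ j

colourClass-hits : (φ : Blocks n m r) → ∀ {c : Fin n → Fin r} → SeesAll (block φ) c →
                   ∀ j → Hits φ (colourClass c j)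
colourClass-hits φ {c} all j x with v , eq , cv≡j ← all x j =
  v , ∈-image id (λ v → c v ≟ j) cv≡j , eq

sum-colourClasses : (c : Fin n → Fin r) → sum (λ j → ∣ colourClass c j ∣) ℕ.≤ n
sum-colourClasses {n} c = begin
  sum (λ j → ∣ colourClass c j ∣)         ≤⟨ sum-mono (λ j → ∣image∣ id λ v → c v ≟ j) ⟩
  sum (λ j → sum (λ v → ind (c v ≟ j)))  ≡⟨ sum-columns (λ j v → ind (c v ≟ j)) (λ v → sum-ind-≟ (c v)) ⟩
  n ℕ.* 1                                ≡⟨ ℕ.*-identityʳ n ⟩
  n                                      ∎
  where open ℕ.≤-Reasoning

hitTwo : (φ ψ : Blocks n m (suc r)) → ∃ λ S → (Hits φ S × Hits ψ S) × suc r ℕ.* ∣ S ∣ ℕ.≤ n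
hitTwo φ ψ
  -- The descent may start anywhere; positions within the cliques of `φ` supply an initial
  -- colouring.
  with c , allφ , allψ ← rainbow (block-minDegree φ) (block-minDegree ψ) (proj₂ ∘ Inverse.to φ)
  with j , avg ← below-average (λ j → ∣ colourClass c j ∣) =
  colourClass c j , (colourClass-hits φ allφ j , colourClass-hits ψ allψ j)
  , ℕ.≤-trans avg (sum-colourClasses c)

-- Summed over all colours, the classes contribute at most `n`, and each of the `m` representatives
-- is added for the `r` colours other than its own. A colour that is no worse than average gives the
-- bound.
hitThree : (φ ψ χ : Blocks n m (suc r)) →
  ∃ λ S → (Hits φ S × Hits ψ S × Hits χ S) × suc r ℕ.* ∣ S ∣ ℕ.≤ n ℕ.+ m ℕ.* r
hitThree {n} {m} {r} φ ψ χ
  with c , allφ , allψ ← rainbow (block-minDegree φ) (block-minDegree ψ) (proj₂ ∘ Inverse.to φ) =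
  S j
  , ( hits-⊆ φ (p⊆p∪q _) (colourClass-hits φ allφ j)
    , hits-⊆ ψ (p⊆p∪q _) (colourClass-hits ψ allψ j) , hitsχ)
  , ℕ.≤-trans (proj₂ best) size
  where
  rep : Fin m → Fin n
  rep x = Inverse.from χ (x , zero)
  other? : ∀ j x → Dec (c (rep x) ≢ j)
  other? j x = ¬? (c (rep x) ≟ j)
  S : Fin (suc r) → Subset n
  S j = colourClass c j ∪ image rep (other? j)
  best = below-average (λ j → ∣ S j ∣)
  j = proj₁ best
  hitsχ : Hits χ (S j)
  -- A representative of colour `j` already lies in the class; any other one was added.
  hitsχ x with c (rep x) ≟ j
  ... | yes eq = rep x , p⊆p∪q _ (∈-image id (λ v → c v ≟ j) eq) , block-from χ x zero
  ... | no ≢j  = rep x , q⊆p∪q _ _ (∈-image rep (other? j) ≢j) , block-from χ x zero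
  size : sum (λ j → ∣ S j ∣) ℕ.≤ n ℕ.+ m ℕ.* r
  size = begin
    sum (λ j → ∣ S j ∣)
      ≤⟨ sum-mono (λ j → ∣p∪q∣≤∣p∣+∣q∣ (colourClass c j) (image rep (other? j))) ⟩
    sum (λ j → ∣ colourClass c j ∣ ℕ.+ ∣ image rep (other? j) ∣)
      ≡⟨ ∑-distrib-+ (λ j → ∣ colourClass c j ∣) (λ j → ∣ image rep (other? j) ∣) ⟩
    sum (λ j → ∣ colourClass c j ∣) ℕ.+ sum (λ j → ∣ image rep (other? j) ∣)
      ≤⟨ ℕ.+-mono-≤ (sum-colourClasses c) (sum-mono λ j → ∣image∣ rep (other? j)) ⟩
    n ℕ.+ sum (λ j → sum (λ x → ind (other? j x)))
      ≡⟨ cong (n ℕ.+_) (sum-columns (λ j x → ind (other? j x)) (λ x → sum-ind-≢ (c (rep x)))) ⟩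
    n ℕ.+ m ℕ.* r ∎
    where open ℕ.≤-Reasoning

∪-bound : ∀ s (S T : Subset n) {x y} → s ℕ.* ∣ S ∣ ℕ.≤ x → s ℕ.* ∣ T ∣ ℕ.≤ y →
          s ℕ.* ∣ S ∪ T ∣ ℕ.≤ x ℕ.+ y
∪-bound s S T {x} {y} hS hT = begin
  s ℕ.* ∣ S ∪ T ∣                 ≤⟨ ℕ.*-monoʳ-≤ s (∣p∪q∣≤∣p∣+∣q∣ S T) ⟩
  s ℕ.* (∣ S ∣ ℕ.+ ∣ T ∣)         ≡⟨ ℕ.*-distribˡ-+ s ∣ S ∣ ∣ T ∣ ⟩
  s ℕ.* ∣ S ∣ ℕ.+ s ℕ.* ∣ T ∣     ≤⟨ ℕ.+-mono-≤ hS hT ⟩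
  x ℕ.+ y                         ∎
  where open ℕ.≤-Reasoning

hitEven : ∀ q (φ : Fin (q ℕ.* 2) → Blocks n m (suc r)) →
  ∃ λ S → (∀ i → Hits (φ i) S) × suc r ℕ.* ∣ S ∣ ℕ.≤ q ℕ.* n
hitEven {n} {r = r} zero φ =
  ⊥ , (λ ()) , ℕ.≤-reflexive (trans (cong (suc r ℕ.*_) (∣⊥∣≡0 n)) (ℕ.*-zeroʳ (suc r)))
hitEven {n} {r = r} (suc q) φ
  with S , (h₀ , h₁) , S≤ ← hitTwo (φ zero) (φ (suc zero))
  with T , h , T≤ ← hitEven q (λ i → φ (suc (suc i))) =
  S ∪ T
  , (λ { zero → hits-⊆ (φ zero) (p⊆p∪q T) h₀
       ; (suc zero) → hits-⊆ (φ (suc zero)) (p⊆p∪q T) h₁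
       ; (suc (suc i)) → hits-⊆ (φ (suc (suc i))) (q⊆p∪q S T) (h i) })
  , ∪-bound (suc r) S T S≤ T≤

-- The first three factors absorb the odd one; the remaining ones are handled in pairs.
hitOdd : ∀ q (φ : Fin (3 ℕ.+ q ℕ.* 2) → Blocks n m (suc r)) →
  ∃ λ S → (∀ i → Hits (φ i) S) × suc r ℕ.* ∣ S ∣ ℕ.≤ (n ℕ.+ m ℕ.* r) ℕ.+ q ℕ.* n
hitOdd {n} {r = r} q φ
  with S , (h₀ , h₁ , h₂) , S≤ ← hitThree (φ zero) (φ (suc zero)) (φ (suc (suc zero)))
  with T , h , T≤ ← hitEven q (λ i → φ (suc (suc (suc i)))) =
  S ∪ T
  , (λ { zero → hits-⊆ (φ zero) (p⊆p∪q T) h₀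
       ; (suc zero) → hits-⊆ (φ (suc zero)) (p⊆p∪q T) h₁
       ; (suc (suc zero)) → hits-⊆ (φ (suc (suc zero))) (p⊆p∪q T) h₂
       ; (suc (suc (suc i))) → hits-⊆ (φ (suc (suc (suc i)))) (q⊆p∪q S T) (h i) })
  , ∪-bound (suc r) S T S≤ T≤

-- From meeting all cliques to simultaneous domination

module _ {k : ℕ} (F : Fin k → Graph (Fin n)) (F≅ : ∀ i → F i ≅ copies m (K r)) where

  blocks : Fin k → Blocks n m r
  blocks i = _≅_.bijection (F≅ i)

  -- The clique of `v` contains some `u` of `S`. Equal positions would force `u` and `v` to
  -- coincide, against `v ∉ S`; so they are adjacent.
  hits⇒simDominating : ∀ {S} → (∀ i → Hits (blocks i) S) → SimDominating F S
  hits⇒simDominating {S} hits i v v∉S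
    with u , u∈S , eq ← hits i (block (blocks i) v) =
    u , u∈S , Equivalence.from (_≅_.adjacency (F≅ i) v u) (sym eq , λ eq₂ →
      v∉S (subst (_∈ S) (to-injective (blocks i) (cong₂ _,_ eq (sym eq₂))) u∈S))

  γsd≤ : ∀ {S} → (∀ i → Hits (blocks i) S) → γsd F ℕ.≤ ∣ S ∣
  γsd≤ {S} hits = proj₂ (γsd-isMinimum F) ∣ S ∣ (S , hits⇒simDominating hits , refl)

-- Translation into rational bounds

/-bound : ∀ s p d n .{{_ : NonZero d}} → + s ℤ.* + d ℤ.≤ p ℤ.* + n → + s / 1 ≤ (p / d) * (+ n / 1)
/-bound s p (suc d) n sd≤pn = ℚ.toℚᵘ-cancel-≤ (begin
  -- Unnormalised fractions reduce the claim to cross multiplication; `mkℚᵘ` takes the denominator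
  -- minus one.
  toℚᵘ (+ s / 1)                              ≃⟨ ℚ.toℚᵘ-fromℚᵘ (ℚᵘ.mkℚᵘ (+ s) 0) ⟩
  ℚᵘ.mkℚᵘ (+ s) 0                               ≤⟨ ℚᵘ.*≤* cross ⟩
  ℚᵘ.mkℚᵘ p d ℚᵘ.* ℚᵘ.mkℚᵘ (+ n) 0
    ≃⟨ ℚᵘ.*-cong (ℚ.toℚᵘ-fromℚᵘ (ℚᵘ.mkℚᵘ p d)) (ℚ.toℚᵘ-fromℚᵘ (ℚᵘ.mkℚᵘ (+ n) 0)) ⟨
  toℚᵘ (p / suc d) ℚᵘ.* toℚᵘ (+ n / 1)      ≃⟨ ℚ.toℚᵘ-homo-* (p / suc d) (+ n / 1) ⟨
  toℚᵘ ((p / suc d) * (+ n / 1))              ∎)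
  where
  open ℚᵘ.≤-Reasoning
  cross : + s ℤ.* + (suc d ℕ.* 1) ℤ.≤ (p ℤ.* + n) ℤ.* + 1
  cross rewrite ℕ.*-identityʳ d | ℤ.*-identityʳ (p ℤ.* + n) = sd≤pn

evenBound : ∀ r q s n → r ℕ.* s ℕ.≤ q ℕ.* n → + s ℤ.* + (2 ℕ.* r) ℤ.≤ + (q ℕ.* 2) ℤ.* + n
evenBound r q s n rs≤ = subst₂ ℤ._≤_ (ℤ.pos-* s _) (ℤ.pos-* (q ℕ.* 2) n)
  (ℤ.+≤+ (subst₂ ℕ._≤_ (lhs r s) (rhs q n) (ℕ.*-monoʳ-≤ 2 rs≤)))
  where
  lhs : ∀ r s → 2 ℕ.* (r ℕ.* s) ≡ s ℕ.* (2 ℕ.* r)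
  lhs = ℕ.solve-∀
  rhs : ∀ q n → 2 ℕ.* (q ℕ.* n) ≡ q ℕ.* 2 ℕ.* n
  rhs = ℕ.solve-∀

-- Write `R = suc r`, `N = m * R` and `k = 3 + 2q`. Since `m * r` is `N - m`, multiplying the
-- hypothesis by `2 * R` makes its right side `R * (k + 1) * N - 2 * N`. To avoid subtraction in ℕ,
-- `2 * N` is first added to both sides and then taken away in ℤ.
oddBound : ∀ r q s m n → n ≡ m ℕ.* suc r → suc r ℕ.* s ℕ.≤ (n ℕ.+ m ℕ.* r) ℕ.+ q ℕ.* n →
           + s ℤ.* + (2 ℕ.* suc r ℕ.^ 2) ℤ.≤
           (+ suc r ℤ.* (+ (3 ℕ.+ q ℕ.* 2) ℤ.+ + 1) ℤ.- + 2) ℤ.* + n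
oddBound r q s m _ refl rs≤ = begin
  + s ℤ.* + (2 ℕ.* R ℕ.^ 2)                      ≡⟨ ℤ.pos-* s _ ⟨
  + A                                            ≡⟨ add-subtract (+ A) (+ (2 ℕ.* N)) ⟩
  (+ A ℤ.+ + (2 ℕ.* N)) ℤ.- + (2 ℕ.* N)          ≤⟨ ℤ.+-monoˡ-≤ (ℤ.- + (2 ℕ.* N)) (ℤ.+≤+ A+2N≤) ⟩
  + (R ℕ.* (k ℕ.+ 1) ℕ.* N) ℤ.- + (2 ℕ.* N)
    ≡⟨ cong₂ ℤ._-_ (trans (ℤ.pos-* (R ℕ.* (k ℕ.+ 1)) N) (cong (ℤ._* + N) (ℤ.pos-* R (k ℕ.+ 1)))) (ℤ.pos-* 2 N) ⟩
  + R ℤ.* + (k ℕ.+ 1) ℤ.* + N ℤ.- + 2 ℤ.* + N    ≡⟨ factor (+ R ℤ.* + (k ℕ.+ 1)) (+ 2) (+ N) ⟩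
  (+ R ℤ.* (+ k ℤ.+ + 1) ℤ.- + 2) ℤ.* + N        ∎
  where
  open ℤ.≤-Reasoning
  R = suc r
  k = 3 ℕ.+ q ℕ.* 2
  N = m ℕ.* R
  A = s ℕ.* (2 ℕ.* R ℕ.^ 2)
  add-subtract : ∀ a b → a ≡ a ℤ.+ b ℤ.- b
  add-subtract = ℤ.solve-∀
  factor : ∀ x t n → x ℤ.* n ℤ.- t ℤ.* n ≡ (x ℤ.- t) ℤ.* n
  factor = ℤ.solve-∀
  -- `R * (R * 1)` is what `R ^ 2` unfolds to.
  lhs : ∀ s R m → 2 ℕ.* R ℕ.* (R ℕ.* s) ℕ.+ 2 ℕ.* (m ℕ.* R) ≡
                  s ℕ.* (2 ℕ.* (R ℕ.* (R ℕ.* 1))) ℕ.+ 2 ℕ.* (m ℕ.* R)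
  lhs = ℕ.solve-∀
  rhs : ∀ m r q → 2 ℕ.* (1 ℕ.+ r) ℕ.* ((m ℕ.* (1 ℕ.+ r) ℕ.+ m ℕ.* r) ℕ.+ q ℕ.* (m ℕ.* (1 ℕ.+ r)))
                  ℕ.+ 2 ℕ.* (m ℕ.* (1 ℕ.+ r)) ≡
                  (1 ℕ.+ r) ℕ.* (3 ℕ.+ q ℕ.* 2 ℕ.+ 1) ℕ.* (m ℕ.* (1 ℕ.+ r))
  rhs = ℕ.solve-∀
  A+2N≤ : A ℕ.+ 2 ℕ.* N ℕ.≤ R ℕ.* (k ℕ.+ 1) ℕ.* N
  A+2N≤ = subst₂ ℕ._≤_ (lhs s R m) (rhs m r q)
    (ℕ.+-monoˡ-≤ (2 ℕ.* N) (ℕ.*-monoʳ-≤ (2 ℕ.* R) rs≤))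

-- The two parities of the number of factors

odd-form : ∀ {k} → 2 ℕ.≤ k → 2 ∤ k → ∃ λ q → k ≡ 3 ℕ.+ q ℕ.* 2
odd-form {1} (s≤s ()) _
odd-form {2} _ 2∤k = contradiction (divides 1 refl) 2∤k
odd-form {3} _ _   = 0 , refl
odd-form {suc (suc k@(suc (suc _)))} _ 2∤2+k
  with q , eq ← odd-form {k} (s≤s (s≤s z≤n)) (λ { (divides p eq) → 2∤2+k (divides (suc p) (cong (2 ℕ.+_) eq)) })
  = suc q , cong (2 ℕ.+_) eq

γsd-even : ∀ q (F : Fin (q ℕ.* 2) → Graph (Fin n)) → (∀ i → F i ≅ copies m (K (suc r))) →
           suc r ℕ.* γsd F ℕ.≤ q ℕ.* n
γsd-even {r = r} q F F≅ =
  ℕ.≤-trans (ℕ.*-monoʳ-≤ (suc r) (γsd≤ F F≅ (proj₁ (proj₂ hit)))) (proj₂ (proj₂ hit))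
  where hit = hitEven q (blocks F F≅)

γsd-odd : ∀ q (F : Fin (3 ℕ.+ q ℕ.* 2) → Graph (Fin n)) → (∀ i → F i ≅ copies m (K (suc r))) →
          suc r ℕ.* γsd F ℕ.≤ (n ℕ.+ m ℕ.* r) ℕ.+ q ℕ.* n
γsd-odd {r = r} q F F≅ =
  ℕ.≤-trans (ℕ.*-monoʳ-≤ (suc r) (γsd≤ F F≅ (proj₁ (proj₂ hit)))) (proj₂ (proj₂ hit))
  where hit = hitOdd q (blocks F F≅)

theorem20 : (r n : ℕ) .{{_ : NonZero r}} → r ℕ.≤ n → n ℕ.% r ≡ 0 →
    (k : ℕ) → 2 ℕ.≤ k →
    (F : Fin k → Graph (Fin n)) →
    (∀ i → F i ≅ copies (n ℕ./ r) (K r)) →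
    (2 ∣ k → + γsd F / 1 ≤ (_/_ (+ k) (2 ℕ.* r) {{2*r≢0 r}}) * (+ n / 1)) ×
    (2 ∤ k → + γsd F / 1 ≤
    (_/_ (+ r ℤ.* (+ k ℤ.+ + 1) ℤ.- + 2) (2 ℕ.* r ℕ.^ 2) {{2*r²≢0 r}}) * (+ n / 1))
theorem20 (suc r) n _ n%r≡0 k 2≤k F F≅ = even , λ 2∤k → odd (odd-form 2≤k 2∤k)
  where
  R = suc r
  M = n ℕ./ R

  -- Divisibility makes the quotient exact, so that the odd bound can express the number of cliques
  -- through `n`.
  n≡MR : n ≡ M ℕ.* R
  n≡MR = trans (m≡m%n+[m/n]*n n R) (cong (ℕ._+ M ℕ.* R) n%r≡0)

  even : 2 ∣ k → + γsd F / 1 ≤ (_/_ (+ k) (2 ℕ.* R) {{2*r≢0 R}}) * (+ n / 1)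
  even (divides q refl) = /-bound (γsd F) (+ k) (2 ℕ.* R) n {{2*r≢0 R}}
    (evenBound R q (γsd F) n (γsd-even q F F≅))

  odd : (∃ λ q → k ≡ 3 ℕ.+ q ℕ.* 2) → + γsd F / 1 ≤
        (_/_ (+ R ℤ.* (+ k ℤ.+ + 1) ℤ.- + 2) (2 ℕ.* R ℕ.^ 2) {{2*r²≢0 R}}) * (+ n / 1)
  odd (q , refl) = /-bound (γsd F) (+ R ℤ.* (+ k ℤ.+ + 1) ℤ.- + 2) (2 ℕ.* R ℕ.^ 2) n {{2*r²≢0 R}}
    (oddBound r q (γsd F) M n n≡MR (γsd-odd q F F≅))
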